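{- For every odd prime $n$, the graph $K_n \Box K_n$ admits a transitive $H$-decomposition in which $H$ is a path with $n(n-1)$ edges.
   Context: $K_n \Box K_n$ denotes the Cartesian product of two complete graphs on $n$ vertices: vertex set $\mathbb{Z}_n \times \mathbb{Z}_n$, with $(a,b)$ and $(c,d)$ adjacent iff they are distinct and $a=c$ or $b=d$. For graphs $H$ and $\Gamma$, an $H$-decomposition of $\Gamma$ is a collection $\mathcal{D}$ of edge-disjoint subgraphs of $\Gamma$, each isomorphic to $H$, whose edge sets partition $E(\Gamma)$. For a group $G$ of automorphisms of $\Gamma$, the decomposition is $G$-transitive if $H'^g\in\mathcal{D}$ for all $H'\in\mathcal{D}$, $g\in G$, and $G$ acts transitively on $\mathcal{D}$; a decomposition is transitive if it is $G$-transitive for some $G\leqslant \mathrm{Aut}(\Gamma)$. -}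

module Defs where

open import Data.Nat using (ℕ; suc; _*_; _∸_)
open import Data.Fin using (Fin; inject₁) renaming (suc to fsuc)
open import Data.Product using (Σ; _×_; _,_; proj₁)
open import Data.Sum using (_⊎_)
open import Data.Empty using (⊥)
open import Relation.Nullary using (¬_)
open import Relation.Binary.PropositionalEquality using (_≡_)
open import Function using (_∘_; id)
open import Function.Bundles using (_⇔_)
open import Level using (0ℓ) renaming (suc to lsuc)

Vertex : ℕ → Set
Vertex n = Fin n × Fin n

Adj : (n : ℕ) → Vertex n → Vertex n → Set
Adj n (a , b) (c , d) = ¬ ((a , b) ≡ (c , d)) × ((a ≡ c) ⊎ (b ≡ d))

record Aut (n : ℕ) : Set where
  field
    to       : Vertex n → Vertex n
    from     : Vertex n → Vertex n
    to-from  : ∀ x → to (from x) ≡ x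
    from-to  : ∀ x → from (to x) ≡ x
    adj-pres : ∀ x y → Adj n x y ⇔ Adj n (to x) (to y)
open Aut public

record IsAutGroup (n : ℕ) (G : Aut n → Set) : Set where
  field
    has-id   : Σ (Aut n) λ e → G e × (∀ x → to e x ≡ x)
    has-comp : ∀ g h → G g → G h →
               Σ (Aut n) λ k → G k × (∀ x → to k x ≡ to g (to h x))
    has-inv  : ∀ g → G g →
               Σ (Aut n) λ k → G k × (∀ x → to k x ≡ from g x)

record PathIn (n m : ℕ) : Set where
  field
    vert     : Fin (suc m) → Vertex n
    injective : ∀ i j → vert i ≡ vert j → i ≡ j
    adjacent : ∀ (t : Fin m) → Adj n (vert (inject₁ t)) (vert (fsuc t))
open PathIn public

EdgeOf : {n m : ℕ} → (Fin (suc m) → Vertex n) → Vertex n → Vertex n → Set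
EdgeOf {n} {m} v x y =
  Σ (Fin m) λ t → ((v (inject₁ t) ≡ x) × (v (fsuc t) ≡ y))
                ⊎ ((v (inject₁ t) ≡ y) × (v (fsuc t) ≡ x))

-- Two vertex sequences determine the same subgraph (same edge set; paths
-- have no isolated vertices, so the vertex sets agree too).
SameSubgraph : {n m : ℕ} → (Fin (suc m) → Vertex n) → (Fin (suc m) → Vertex n) → Set
SameSubgraph v w = ∀ x y → EdgeOf v x y ⇔ EdgeOf w x y

record PathDecomposition (n m : ℕ) : Set where
  field
    k     : ℕ
    path  : Fin k → PathIn n m
    cover : ∀ x y → Adj n x y →
            Σ (Fin k) λ i → EdgeOf (vert (path i)) x y ×
                            (∀ j → EdgeOf (vert (path j)) x y → j ≡ i)
open PathDecomposition public

IsGTransitive : {n m : ℕ} → (G : Aut n → Set) → PathDecomposition n m → Set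
IsGTransitive G D =
    (∀ i g → G g → Σ (Fin (k D)) λ j →
        SameSubgraph (to g ∘ vert (path D i)) (vert (path D j)))
  × (∀ i j → Σ (Aut _) λ g → G g ×
        SameSubgraph (to g ∘ vert (path D i)) (vert (path D j)))

IsTransitive : {n m : ℕ} → PathDecomposition n m → Set₁
IsTransitive {n} D = Σ (Aut n → Set) λ G → IsAutGroup n G × IsGTransitive G D

{-# OPTIONS --safe #-}
module Submission where

-- Write n = 2m + 1. The decomposition is the orbit of one walk under the n translations of the
-- second coordinate. The walk has m phases; on vertices (a , b), phase t alternates steps
-- a ↦ a + (2t+1) and b ↦ b + (2t+1), starting at a = 0, except that its last step is
-- b ↦ b + (2t+2). So b - a alternates between t and -(t+1) during phase t, and over all phases
-- it runs through the zigzag 0, -1, 1, -2, 2, …, m; within a phase each of t and -(t+1) is met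
-- once for every a, because 2t+1 is invertible mod n. Hence the walk is a path. Up to sign,
-- 1, 3, …, 2m-1 are all the nonzero differences mod n, and so are 2, 4, …, 2m; therefore the path
-- meets each translation class of edges exactly once.

open import Defs
open import Data.Nat using (ℕ; zero; suc; s≤s; z<s; ⌊_/2⌋; ⌈_/2⌉)
import Data.Nat as ℕ
import Data.Nat.Properties as ℕ
import Data.Nat.DivMod as ℕ
import Data.Nat.Divisibility as ℕ
open import Data.Nat.Coprimality using (prime⇒coprime; coprime-Bézout)
open import Data.Nat.GCD using (module Bézout)
open import Data.Nat.Primality using (Prime)
open import Data.Integer using (ℤ; +_; -_; _+_; _-_)
import Data.Integer as ℤ
import Data.Integer.Properties as ℤ
open import Data.Integer.DivMod using (_%ℕ_; _/ℕ_; n%ℕd<d; a≡a%ℕn+[a/ℕn]*n)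
open import Data.Integer.Divisibility.Signed
  using (divides; ∣m∣n⇒∣m+n; ∣m⇒∣-m; ∣n⇒∣m*n; ∣⇒∣ᵤ)
open import Data.Integer.Tactic.RingSolver using (solve-∀)
open import Data.Fin using (Fin; toℕ; fromℕ<; inject₁) renaming (suc to fsuc)
open import Data.Fin.Properties using (toℕ<n; toℕ-fromℕ<; toℕ-injective; toℕ-inject₁)
open import Data.Product using (Σ; ∃; _×_; _,_; proj₁; proj₂)
open import Data.Sum as Sum using (_⊎_; inj₁; inj₂; [_,_]′)
open import Function using (_∘_; id; mk⇔)
open import Relation.Nullary using (¬_; yes; no; contradiction)
open import Relation.Binary.PropositionalEquality

-- Parity and halving of natural numbers.

parity : ∀ s → ∃ λ q → s ≡ q ℕ.* 2 ⊎ s ≡ suc (q ℕ.* 2)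
parity zero          = 0 , inj₁ refl
parity (suc zero)    = 0 , inj₂ refl
parity (suc (suc s)) with parity s
... | q , inj₁ eq = suc q , inj₁ (cong (suc ∘ suc) eq)
... | q , inj₂ eq = suc q , inj₂ (cong (suc ∘ suc) eq)

⌊q*2/2⌋≡q : ∀ q → ⌊ q ℕ.* 2 /2⌋ ≡ q
⌊q*2/2⌋≡q zero    = refl
⌊q*2/2⌋≡q (suc q) = cong suc (⌊q*2/2⌋≡q q)

⌊1+q*2/2⌋≡q : ∀ q → ⌊ suc (q ℕ.* 2) /2⌋ ≡ q
⌊1+q*2/2⌋≡q zero    = refl
⌊1+q*2/2⌋≡q (suc q) = cong suc (⌊1+q*2/2⌋≡q q)

module Construction (m : ℕ) (n-prime : Prime (suc (m ℕ.* 2))) where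

  open import Data.Integer using (_*_)
  open import Data.Integer.Divisibility.Signed using (_∣_)

  odd : ℕ → ℤ
  odd t = + 1 + + 2 * + t

  odd-suc : ∀ t → + suc (t ℕ.* 2) ≡ odd t
  odd-suc t = cong (λ x → + 1 + x) (trans (ℤ.pos-* t 2) (ℤ.*-comm (+ t) (+ 2)))

  N : ℕ
  N = suc (m ℕ.* 2)

  -- Congruence modulo N

  infix 4 _≈_
  record _≈_ (x y : ℤ) : Set where
    constructor mk≈
    field N∣x-y : + N ∣ x - y

  infixl 6 _by_ _⊞_ _⊟_
  infixl 7 _⊡_

  -- Every linear manipulation of congruences is a combination p ⊞ q ⊟ c ⊡ r whose difference
  -- of sides equals, as a ring identity, that of the desired congruence.
  _by_ : ∀ {x y x′ y′} → x ≈ y → x - y ≡ x′ - y′ → x′ ≈ y′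
  mk≈ p by eq = mk≈ (subst (+ N ∣_) eq p)

  _⊞_ : ∀ {x y x′ y′} → x ≈ y → x′ ≈ y′ → x + x′ ≈ y + y′
  _⊞_ {x} {y} {x′} {y′} (mk≈ p) (mk≈ q) = mk≈ (subst (+ N ∣_) (ring x y x′ y′) (∣m∣n⇒∣m+n p q))
    where
    ring : ∀ x y x′ y′ → (x - y) + (x′ - y′) ≡ (x + x′) - (y + y′)
    ring = solve-∀

  ⊖_ : ∀ {x y} → x ≈ y → - x ≈ - y
  ⊖_ {x} {y} (mk≈ p) = mk≈ (subst (+ N ∣_) (ring x y) (∣m⇒∣-m p))
    where
    ring : ∀ x y → - (x - y) ≡ - x - (- y)
    ring = solve-∀

  _⊟_ : ∀ {x y x′ y′} → x ≈ y → x′ ≈ y′ → x - x′ ≈ y - y′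
  p ⊟ q = p ⊞ ⊖ q

  _⊡_ : ∀ c {x y} → x ≈ y → c * x ≈ c * y
  _⊡_ c {x} {y} (mk≈ p) = mk≈ (subst (+ N ∣_) (ring c x y) (∣n⇒∣m*n c p))
    where
    ring : ∀ c x y → c * (x - y) ≡ c * x - c * y
    ring = solve-∀

  ≈-reflexive : ∀ {x y} → x ≡ y → x ≈ y
  ≈-reflexive {x} refl = mk≈ (divides (+ 0) (ℤ.+-inverseʳ x))

  ≈-refl : ∀ {x} → x ≈ x
  ≈-refl = ≈-reflexive refl

  ≈-sym : ∀ {x y} → x ≈ y → y ≈ x
  ≈-sym {x} {y} p = ⊖ p by ring x y
    where
    ring : ∀ x y → - x - - y ≡ y - x
    ring = solve-∀

  ≈-trans : ∀ {x y z} → x ≈ y → y ≈ z → x ≈ z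
  ≈-trans {x} {y} {z} p q = p ⊞ q by ring x y z
    where
    ring : ∀ x y z → (x + y) - (y + z) ≡ x - z
    ring = solve-∀

  N≈0 : + N ≈ + 0
  N≈0 = mk≈ (divides (+ 1) (ring (+ N)))
    where
    ring : ∀ n → n - + 0 ≡ + 1 * n
    ring = solve-∀

  residue : ℤ → Fin N
  residue z = fromℕ< (n%ℕd<d z N)

  ι : Fin N → ℤ
  ι i = + toℕ i

  ι-residue : ∀ z → ι (residue z) ≈ z
  ι-residue z = ≈-sym (mk≈ (divides (z /ℕ N) (begin
    z - ι (residue z)                          ≡⟨ cong (λ r → z - + r) (toℕ-fromℕ< (n%ℕd<d z N)) ⟩
    z - + (z %ℕ N)                             ≡⟨ cong (_- + (z %ℕ N)) (a≡a%ℕn+[a/ℕn]*n z N) ⟩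
    + (z %ℕ N) + z /ℕ N * + N - + (z %ℕ N)     ≡⟨ ring (+ (z %ℕ N)) (z /ℕ N * + N) ⟩
    z /ℕ N * + N                               ∎)))
    where
    open ≡-Reasoning
    ring : ∀ r d → r + d - r ≡ d
    ring = solve-∀

  -- Two numbers in [0, N) differ by less than N in absolute value.
  ≈⇒≡ : ∀ {x y} → x ℕ.< N → y ℕ.< N → + x ≈ + y → x ≡ y
  ≈⇒≡ {x} {y} x<N y<N (mk≈ p) =
    ℤ.+-injective (ℤ.i-j≡0⇒i≡j (+ x) (+ y) (ℤ.∣i∣≡0⇒i≡0 (multiple<N (∣⇒∣ᵤ p) ∣x-y∣<N)))
    where
    multiple<N : ∀ {d} → N ℕ.∣ d → d ℕ.< N → d ≡ 0
    multiple<N {zero}  _   _   = refl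
    multiple<N {suc d} N∣d d<N = contradiction N∣d (ℕ.>⇒∤ d<N)
    ∣x-y∣<N : ℤ.∣ + x - + y ∣ ℕ.< N
    ∣x-y∣<N = ℕ.≤-<-trans
      (subst (λ z → ℤ.∣ z ∣ ℕ.≤ x ℕ.⊔ y) (sym (ℤ.m-n≡m⊖n x y)) (ℤ.∣m⊝n∣≤m⊔n x y))
      (ℕ.⊔-pres-<m x<N y<N)

  ι-injective : ∀ {i j} → ι i ≈ ι j → i ≡ j
  ι-injective {i} {j} p = toℕ-injective (≈⇒≡ (toℕ<n i) (toℕ<n j) p)

  residue-cong : ∀ {x y} → x ≈ y → residue x ≡ residue y
  residue-cong {x} {y} p =
    ι-injective (≈-trans (ι-residue x) (≈-trans p (≈-sym (ι-residue y))))

  residue-ι : ∀ i → residue (ι i) ≡ i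
  residue-ι i = ι-injective (ι-residue (ι i))

  -- The residues `2t + 1` and `2t + 2` modulo `N`.

  double≈0 : ∀ {x} → + 2 * x ≈ + 0 → x ≈ + 0
  -- Since `N = 2m + 1`, the combination `x * N - m * (2 * x)` equals `x`.
  double≈0 {x} p = x ⊡ N≈0 ⊟ + m ⊡ p by
    trans (cong (λ n → x * n - + m * (+ 2 * x) - (x * + 0 - + m * + 0)) (odd-suc m))
      (ring x (+ m))
    where
    ring : ∀ x M → x * (+ 1 + + 2 * M) - M * (+ 2 * x) - (x * + 0 - M * + 0) ≡ x - + 0
    ring = solve-∀

  -- The sum lies between 1 and `2m`, hence strictly between 0 and `N`. The facts about opposite
  -- increments and the separation of `up` from `down` vertices all reduce to this.
  sum≉0 : ∀ {t t′} → t ℕ.< m → t′ ℕ.≤ m → ¬ + suc t + + t′ ≈ + 0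
  sum≉0 {t} {t′} t<m t′≤m p = ℕ.1+n≢0 (≈⇒≡ (s≤s bound) z<s p)
    where
    open ℕ.≤-Reasoning
    bound : suc t ℕ.+ t′ ℕ.≤ m ℕ.* 2
    bound = begin
      suc t ℕ.+ t′    ≤⟨ ℕ.+-mono-≤ t<m t′≤m ⟩
      m ℕ.+ m         ≡⟨ cong (m ℕ.+_) (sym (ℕ.+-identityʳ m)) ⟩
      2 ℕ.* m         ≡⟨ ℕ.*-comm 2 m ⟩
      m ℕ.* 2         ∎

  -- The sum is `2 * (t + t′ + 1)`, and 2 can be cancelled. Thus no edge is traversed in both
  -- directions by odd increments.
  odd-opposite : ∀ {t t′} → t ℕ.< m → t′ ℕ.< m → ¬ odd t + odd t′ ≈ + 0
  odd-opposite {t} {t′} t<m t′<m p =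
    sum≉0 t<m (ℕ.<⇒≤ t′<m) (double≈0 {+ suc t + + t′} (p by ring (+ t) (+ t′)))
    where
    ring : ∀ x y → + 1 + + 2 * x + (+ 1 + + 2 * y) - + 0 ≡ + 2 * (+ 1 + x + y) - + 0
    ring = solve-∀

  odd≉0 : ∀ {t} → t ℕ.< m → ¬ odd t ≈ + 0
  odd≉0 t<m p = odd-opposite t<m t<m (p ⊞ p)

  even : ℕ → ℤ
  even t = + 2 * + suc t

  even-opposite : ∀ {t t′} → t ℕ.< m → t′ ℕ.< m → ¬ even t + even t′ ≈ + 0
  even-opposite {t} {t′} t<m t′<m p =
    sum≉0 t<m t′<m (double≈0 {+ suc t + + suc t′} (p by ring (+ suc t) (+ suc t′)))
    where
    ring : ∀ x y → + 2 * x + + 2 * y - + 0 ≡ + 2 * (x + y) - + 0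
    ring = solve-∀

  even≉0 : ∀ {t} → t ℕ.< m → ¬ even t ≈ + 0
  even≉0 t<m p = even-opposite t<m t<m (p ⊞ p)

  m<N : m ℕ.< N
  m<N = s≤s (ℕ.m≤m*n m 2)

  odd-injective : ∀ {t t′} → t ℕ.< m → t′ ℕ.< m → odd t ≈ odd t′ → t ≡ t′
  odd-injective {t} {t′} t<m t′<m p =
    ≈⇒≡ (ℕ.<-trans t<m m<N) (ℕ.<-trans t′<m m<N)
      (double≈0 {+ t - + t′} (p by ring₁ (+ t) (+ t′)) by ring₂ (+ t) (+ t′))
    where
    ring₁ : ∀ x y → + 1 + + 2 * x - (+ 1 + + 2 * y) ≡ + 2 * (x - y) - + 0
    ring₁ = solve-∀
    ring₂ : ∀ x y → x - y - + 0 ≡ x - y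
    ring₂ = solve-∀

  even-injective : ∀ {t t′} → t ℕ.< m → t′ ℕ.< m → even t ≈ even t′ → t ≡ t′
  even-injective {t} {t′} t<m t′<m p = odd-injective t<m t′<m (p by ring (+ t) (+ t′))
    where
    ring : ∀ x y → + 2 * (+ 1 + x) - + 2 * (+ 1 + y) ≡ + 1 + + 2 * x - (+ 1 + + 2 * y)
    ring = solve-∀

  -- Primality enters here: `0 < 2t + 1 < N` makes the two numbers coprime. It follows that
  -- `i ↦ i * odd t` permutes the residues; `odd-solve` is surjectivity and `odd-cancel`
  -- injectivity.
  odd-inverse : ∀ {t} → t ℕ.< m → ∃ λ u → u * odd t ≈ + 1
  odd-inverse {t} t<m with coprime-Bézout (prime⇒coprime n-prime (s≤s (ℕ.*-monoˡ-< 2 t<m)))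
  -- Here `1 + y * (2t + 1) = x * N`, so the inverse is `- y`; in the other case
  -- `1 + x * N = y * (2t + 1)` and it is `y`.
  ... | Bézout.+- x y eq = - + y , + x ⊡ ⊖ N≈0 by (begin
    + x * - + N - + x * + 0                     ≡⟨ ring₁ (+ x) (+ N) ⟩
    - (+ x * + N)                               ≡⟨ cong -_ (sym (ℤ.pos-* x N)) ⟩
    - + (x ℕ.* N)                               ≡⟨ cong (-_ ∘ +_) (sym eq) ⟩
    - (+ 1 + + (y ℕ.* suc (t ℕ.* 2)))           ≡⟨ cong (λ z → - (+ 1 + z)) (ℤ.pos-* y _) ⟩
    - (+ 1 + + y * + suc (t ℕ.* 2))             ≡⟨ cong (λ z → - (+ 1 + + y * z)) (odd-suc t) ⟩
    - (+ 1 + + y * odd t)                       ≡⟨ ring₂ (+ y) (odd t) ⟩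
    - + y * odd t - + 1                         ∎)
    where
    open ≡-Reasoning
    ring₁ : ∀ x n → x * - n - x * + 0 ≡ - (x * n)
    ring₁ = solve-∀
    ring₂ : ∀ y o → - (+ 1 + y * o) ≡ - y * o - + 1
    ring₂ = solve-∀
  ... | Bézout.-+ x y eq = + y , + x ⊡ N≈0 by (begin
    + x * + N - + x * + 0                       ≡⟨ ring (+ x * + N) (+ x) ⟩
    + 1 + + x * + N - + 1                       ≡⟨ cong (λ z → + 1 + z - + 1) (sym (ℤ.pos-* x N)) ⟩
    + (1 ℕ.+ x ℕ.* N) - + 1                     ≡⟨ cong (λ z → + z - + 1) eq ⟩
    + (y ℕ.* suc (t ℕ.* 2)) - + 1               ≡⟨ cong (_- + 1) (ℤ.pos-* y _) ⟩
    + y * + suc (t ℕ.* 2) - + 1                 ≡⟨ cong (λ z → + y * z - + 1) (odd-suc t) ⟩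
    + y * odd t - + 1                           ∎)
    where
    open ≡-Reasoning
    ring : ∀ p x → p - x * + 0 ≡ + 1 + p - + 1
    ring = solve-∀

  odd-solve : ∀ {t} → t ℕ.< m → ∀ b → ∃ λ i → i ℕ.< N × + i * odd t ≈ b
  odd-solve {t} t<m b with u , uo≈1 ← odd-inverse t<m =
    toℕ i , toℕ<n i , odd t ⊡ ι-residue (u * b) ⊞ b ⊡ uo≈1 by ring (odd t) (ι i) u b
    where
    i : Fin N
    i = residue (u * b)
    ring : ∀ o i u b → o * i + b * (u * o) - (o * (u * b) + b * + 1) ≡ i * o - b
    ring = solve-∀

  odd-cancel : ∀ {t} → t ℕ.< m → ∀ {x y} → x * odd t ≈ y * odd t → x ≈ y
  odd-cancel {t} t<m {x} {y} p with u , uo≈1 ← odd-inverse t<m =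
    u ⊡ p ⊟ (x - y) ⊡ uo≈1 by ring (odd t) u x y
    where
    ring : ∀ o u x y → u * (x * o) - (x - y) * (u * o) - (u * (y * o) - (x - y) * + 1) ≡ x - y
    ring = solve-∀

  -- Let `e` be the least nonnegative residue of `d`. If `e` is odd, it is `odd q` itself; if it is
  -- even and positive, `N - e` is odd and represents `- d`. With `e = 2 * (p + 1)` and
  -- `m = p + 1 + r`, one has `N - e = 2r + 1`.
  ±odd : ∀ d → ¬ d ≈ + 0 → ∃ λ t → t ℕ.< m × (d ≈ odd t ⊎ - d ≈ odd t)
  ±odd d d≉0 with toℕ (residue d) | toℕ<n (residue d) | ι-residue d
  ... | e | e<N | e≈d with parity e
  ... | q , inj₂ refl = q , ℕ.*-cancelʳ-< _ _ _ (ℕ.s<s⁻¹ e<N) ,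
    inj₁ (≈-trans (≈-sym e≈d) (≈-reflexive (odd-suc q)))
  ... | zero , inj₁ refl = contradiction (≈-sym e≈d) d≉0
  ... | suc p , inj₁ refl
      with r , refl ← ℕ.m≤n⇒∃[o]m+o≡n (ℕ.*-cancelʳ-≤ (suc p) m 2 (ℕ.s≤s⁻¹ e<N)) =
    r , s≤s (ℕ.m≤n+m r p) , inj₂ (e≈d ⊟ N≈0 by (begin
      + (suc p ℕ.* 2) - + N - (d - + 0)
        ≡⟨ cong₂ (λ x y → x - y - (d - + 0)) (ℤ.pos-* (suc p) 2) (odd-suc m) ⟩
      + suc p * + 2 - odd m - (d - + 0)            ≡⟨ ring (+ suc p) (+ r) d ⟩
      - d - odd r                                  ∎))
    where
    open ≡-Reasoning
    ring : ∀ p r d → p * + 2 - (+ 1 + + 2 * (p + r)) - (d - + 0) ≡ - d - (+ 1 + + 2 * r)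
    ring = solve-∀

  -- When `t + 1 + r = m`, `odd t + even r = N`, so each odd increment is the negative of an even
  -- one and the two signs of `±odd` change places.
  ±even : ∀ d → ¬ d ≈ + 0 → ∃ λ t → t ℕ.< m × (d ≈ even t ⊎ - d ≈ even t)
  ±even d d≉0 with ±odd d d≉0
  ... | t , t<m , d≈±odd with r , refl ← ℕ.m≤n⇒∃[o]m+o≡n t<m =
    r , s≤s (ℕ.m≤n+m r t) ,
    [ inj₂ ∘ opposite d
    , (λ p → inj₁ (subst (_≈ even r) (ℤ.neg-involutive d) (opposite (- d) p)))
    ]′ d≈±odd
    where
    ring : ∀ t r d → - d - (+ 1 + + 2 * (+ 1 + t + r)) - (- (+ 1 + + 2 * t) - + 0)
                     ≡ - d - + 2 * (+ 1 + r)
    ring = solve-∀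
    odd-m≈0 : odd m ≈ + 0
    odd-m≈0 = subst (_≈ + 0) (odd-suc m) N≈0
    opposite : ∀ d → d ≈ odd t → - d ≈ even r
    opposite d p = ⊖ p ⊟ odd-m≈0 by ring (+ t) (+ r) d

  -- The walk

  phase : ℕ → ℕ
  phase s = ⌊ s /2⌋ ℕ./ N

  -- The positions 2i and 2i + 1 within phase t.
  up down : ℕ → ℕ → ℕ
  up   t i = (i ℕ.+ t ℕ.* N) ℕ.* 2
  down t i = suc (up t i)

  -- The final vertex is treated as position 0 of a phase `m` in which no step is taken.
  length≡up : N ℕ.* (m ℕ.* 2) ≡ up m 0
  length≡up = trans (sym (ℕ.*-assoc N m 2)) (cong (ℕ._* 2) (ℕ.*-comm N m))

  -- Positions that have an outgoing step, so the final vertex is excluded; `t` is the phase and `i`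
  -- counts the pairs of steps completed within it.
  data Index : ℕ → Set where
    at-up   : ∀ {t i} → t ℕ.< m → i ℕ.< N → Index (up t i)
    at-down : ∀ {t i} → t ℕ.< m → i ℕ.< N → Index (down t i)

  index : ∀ {s} → s ℕ.< N ℕ.* (m ℕ.* 2) → Index s
  index {s} s< with parity s
  ... | q , s≡ = view s≡
    where
    s<mN2 : s ℕ.< m ℕ.* N ℕ.* 2
    s<mN2 = subst (s ℕ.<_) length≡up s<
    q/N<m : q ℕ.* 2 ℕ.≤ s → q ℕ./ N ℕ.< m
    q/N<m q≤s = ℕ.m<n*o⇒m/o<n (ℕ.*-cancelʳ-< 2 q (m ℕ.* N) (ℕ.≤-<-trans q≤s s<mN2))
    q≡ : q ℕ.% N ℕ.+ q ℕ./ N ℕ.* N ≡ q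
    q≡ = sym (ℕ.m≡m%n+[m/n]*n q N)
    view : s ≡ q ℕ.* 2 ⊎ s ≡ suc (q ℕ.* 2) → Index s
    view (inj₁ s≡) = subst Index (trans (cong (ℕ._* 2) q≡) (sym s≡))
      (at-up (q/N<m (ℕ.≤-reflexive (sym s≡))) (ℕ.m%n<n q N))
    view (inj₂ s≡) = subst Index (trans (cong (suc ∘ (ℕ._* 2)) q≡) (sym s≡))
      (at-down (q/N<m (ℕ.≤-trans (ℕ.n≤1+n _) (ℕ.≤-reflexive (sym s≡)))) (ℕ.m%n<n q N))

  down<length : ∀ {t i} → t ℕ.< m → i ℕ.< N → down t i ℕ.< N ℕ.* (m ℕ.* 2)
  down<length {t} {i} t<m i<N = begin
    suc (i ℕ.+ t ℕ.* N) ℕ.* 2    ≤⟨ ℕ.*-monoˡ-≤ 2 (ℕ.+-monoˡ-≤ (t ℕ.* N) i<N) ⟩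
    suc t ℕ.* N ℕ.* 2            ≤⟨ ℕ.*-monoˡ-≤ 2 (ℕ.*-monoˡ-≤ N t<m) ⟩
    m ℕ.* N ℕ.* 2                ≡⟨ sym length≡up ⟩
    N ℕ.* (m ℕ.* 2)              ∎
    where open ℕ.≤-Reasoning

  quotient : ∀ t {i} → i ℕ.< N → (i ℕ.+ t ℕ.* N) ℕ./ N ≡ t
  quotient t {i} i<N = begin
    (i ℕ.+ t ℕ.* N) ℕ./ N            ≡⟨ ℕ.+-distrib-/-∣ʳ i (ℕ.divides-refl t) ⟩
    i ℕ./ N ℕ.+ t ℕ.* N ℕ./ N        ≡⟨ cong₂ ℕ._+_ (ℕ.m<n⇒m/n≡0 i<N) (ℕ.m*n/n≡m t N) ⟩
    t                                ∎
    where open ≡-Reasoning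

  phase-up : ∀ t {i} → i ℕ.< N → phase (up t i) ≡ t
  phase-up t {i} i<N = trans (ℕ./-congˡ (⌊q*2/2⌋≡q (i ℕ.+ t ℕ.* N))) (quotient t i<N)

  phase-down : ∀ t {i} → i ℕ.< N → phase (down t i) ≡ t
  phase-down t {i} i<N = trans (ℕ./-congˡ (⌊1+q*2/2⌋≡q (i ℕ.+ t ℕ.* N))) (quotient t i<N)

  reduce : ∀ i t o → + (i ℕ.+ t ℕ.* N) * o ≈ + i * o
  reduce i t o = (+ t * o) ⊡ N≈0 by
    trans (ring (+ i) (+ t) (+ N) o) (cong (λ z → (+ i + z) * o - + i * o) (sym (ℤ.pos-* t N)))
    where
    ring : ∀ i t n o → t * o * n - t * o * + 0 ≡ (i + t * n) * o - i * o
    ring = solve-∀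

  opaque
    -- The number of earlier steps in each coordinate need not be reduced to the current phase:
    -- the n steps of a whole phase contribute 0 mod n.
    walk : Fin N → ℕ → Vertex N
    walk k s = residue (+ ⌈ s /2⌉ * odd (phase s)) ,
               residue (+ phase s + + ⌊ s /2⌋ * odd (phase s) + ι k)

    walk-up₁ : ∀ k t {i} → i ℕ.< N → ι (proj₁ (walk k (up t i))) ≈ + i * odd t
    walk-up₁ k t {i} i<N = ≈-trans (ι-residue _) (≈-trans
      -- `⌈ s /2⌉` is by definition `⌊ suc s /2⌋`. At an even position both halves agree; at an odd
      -- one the first coordinate is one step ahead, which gives `suc i` in `walk-down₁`.
      (≈-reflexive (cong₂ (λ q t → + q * odd t) (⌊1+q*2/2⌋≡q (i ℕ.+ t ℕ.* N)) (phase-up t i<N)))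
      (reduce i t (odd t)))

    walk-up₂ : ∀ k t {i} → i ℕ.< N → ι (proj₂ (walk k (up t i))) ≈ + t + + i * odd t + ι k
    walk-up₂ k t {i} i<N = ≈-trans (ι-residue _) (≈-trans
      (≈-reflexive (cong₂ (λ q t → + t + + q * odd t + ι k) (⌊q*2/2⌋≡q (i ℕ.+ t ℕ.* N)) (phase-up t i<N)))
      (≈-refl {+ t} ⊞ reduce i t (odd t) ⊞ ≈-refl))

    walk-down₁ : ∀ k t {i} → i ℕ.< N → ι (proj₁ (walk k (down t i))) ≈ + suc i * odd t
    walk-down₁ k t {i} i<N = ≈-trans (ι-residue _) (≈-trans
      (≈-reflexive (cong₂ (λ q t → + q * odd t) (⌊q*2/2⌋≡q (suc i ℕ.+ t ℕ.* N)) (phase-down t i<N)))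
      (reduce (suc i) t (odd t)))

    walk-down₂ : ∀ k t {i} → i ℕ.< N → ι (proj₂ (walk k (down t i))) ≈ + t + + i * odd t + ι k
    walk-down₂ k t {i} i<N = ≈-trans (ι-residue _) (≈-trans
      (≈-reflexive (cong₂ (λ q t → + t + + q * odd t + ι k) (⌊1+q*2/2⌋≡q (i ℕ.+ t ℕ.* N)) (phase-down t i<N)))
      (≈-refl {+ t} ⊞ reduce i t (odd t) ⊞ ≈-refl))

    -- The path index enters the walk only as a summand of the second coordinate, so a translation
    -- changes nothing but that index.
    walk-shift : ∀ k l c s → ι k + c ≈ ι l →
                 residue (ι (proj₂ (walk k s)) + c) ≡ proj₂ (walk l s)
    walk-shift k l c s k+c≈l = residue-cong {ι (residue (x + ι k)) + c} {x + ι l}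
      (ι-residue (x + ι k) ⊞ k+c≈l by ring (ι (residue (x + ι k))) x (ι k) c (ι l))
      where
      x : ℤ
      x = + phase s + + ⌊ s /2⌋ * odd (phase s)
      ring : ∀ r x k c l → r + (k + c) - (x + k + l) ≡ r + c - (x + l)
      ring = solve-∀

    walk-shift₁ : ∀ k l s → proj₁ (walk k s) ≡ proj₁ (walk l s)
    walk-shift₁ k l s = refl

  -- Differences of coordinates and injectivity of the walk.

  slope-up : ∀ k t {i} → i ℕ.< N →
             ι (proj₂ (walk k (up t i))) - ι (proj₁ (walk k (up t i))) ≈ + t + ι k
  slope-up k t {i} i<N = walk-up₂ k t i<N ⊟ walk-up₁ k t i<N by
    ring (ι (proj₁ (walk k (up t i)))) (ι (proj₂ (walk k (up t i)))) (+ t) (+ i) (odd t) (ι k)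
    where
    ring : ∀ a b t i o k → b - a - (t + i * o + k - i * o) ≡ b - a - (t + k)
    ring = solve-∀

  -- The first coordinate leads by one increment, and `t - odd t = - (t + 1)`; the terms are
  -- arranged to avoid the negative sign.
  slope-down : ∀ k t {i} → i ℕ.< N →
               ι (proj₂ (walk k (down t i))) + + suc t ≈ ι (proj₁ (walk k (down t i))) + ι k
  slope-down k t {i} i<N = walk-down₂ k t i<N ⊟ walk-down₁ k t i<N by
    ring (ι (proj₁ (walk k (down t i)))) (ι (proj₂ (walk k (down t i)))) (+ t) (+ i) (ι k)
    where
    ring : ∀ a b t i k → b - a - (t + i * (+ 1 + + 2 * t) + k - (+ 1 + i) * (+ 1 + + 2 * t))
                         ≡ b + (+ 1 + t) - (a + k)
    ring = solve-∀

  -- Equal vertices have equal slopes, and `t`, `t′` are below `N`. The bounds admit `m` so that the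
  -- final vertex `up m 0` is covered too.
  up-phase : ∀ k {t t′ i i′} → t ℕ.≤ m → t′ ℕ.≤ m → i ℕ.< N → i′ ℕ.< N →
             walk k (up t i) ≡ walk k (up t′ i′) → t ≡ t′
  up-phase k {t} {t′} {i} {i′} t≤m t′≤m i<N i′<N eq =
    sym (≈⇒≡ (ℕ.≤-<-trans t′≤m m<N) (ℕ.≤-<-trans t≤m m<N)
      (subst (λ v → ι (proj₂ v) - ι (proj₁ v) ≈ + t + ι k) eq (slope-up k t i<N) ⊟ slope-up k t′ i′<N
        by ring (ι (proj₂ (walk k (up t′ i′))) - ι (proj₁ (walk k (up t′ i′)))) (+ t) (+ t′) (ι k)))
    where
    ring : ∀ s t t′ k → s - s - (t + k - (t′ + k)) ≡ t′ - t
    ring = solve-∀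

  -- Relative to `k` the slopes are `t` and `- (t′ + 1)`, and their difference `t + t′ + 1` is
  -- excluded by `sum≉0`.
  up≢down : ∀ k {t t′ i i′} → t ℕ.≤ m → t′ ℕ.< m → i ℕ.< N → i′ ℕ.< N →
            walk k (up t i) ≢ walk k (down t′ i′)
  up≢down k {t} {t′} {i} {i′} t≤m t′<m i<N i′<N eq = sum≉0 t′<m t≤m
    (slope-down k t′ i′<N ⊟ subst (λ v → ι (proj₂ v) - ι (proj₁ v) ≈ + t + ι k) eq (slope-up k t i<N)
      by ring (ι (proj₁ (walk k (down t′ i′)))) (ι (proj₂ (walk k (down t′ i′)))) (+ t) (+ suc t′) (ι k))
    where
    ring : ∀ a b t s k → b + s - (b - a) - (a + k - (t + k)) ≡ s + t - + 0
    ring = solve-∀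

  down-phase : ∀ k {t t′ i i′} → t ℕ.< m → t′ ℕ.< m → i ℕ.< N → i′ ℕ.< N →
               walk k (down t i) ≡ walk k (down t′ i′) → t ≡ t′
  down-phase k {t} {t′} {i} {i′} t<m t′<m i<N i′<N eq =
    ≈⇒≡ (ℕ.<-trans t<m m<N) (ℕ.<-trans t′<m m<N)
      (subst (λ v → ι (proj₂ v) + + suc t ≈ ι (proj₁ v) + ι k) eq (slope-down k t i<N)
        ⊟ slope-down k t′ i′<N
        by ring (ι (proj₁ (walk k (down t′ i′)))) (ι (proj₂ (walk k (down t′ i′)))) (+ t) (+ t′) (ι k))
    where
    ring : ∀ a b t t′ k → b + (+ 1 + t) - (b + (+ 1 + t′)) - (a + k - (a + k)) ≡ t - t′
    ring = solve-∀

  -- Within one phase the first coordinate `i * odd t` determines `i`, because `odd t` is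
  -- invertible.
  up-injective : ∀ k {t t′ i i′} → t ℕ.< m → i ℕ.< N → i′ ℕ.< N → t ≡ t′ →
                 walk k (up t i) ≡ walk k (up t′ i′) → up t i ≡ up t′ i′
  up-injective k {t} {_} {i} {i′} t<m i<N i′<N refl eq = cong (up t) (≈⇒≡ i<N i′<N
    (odd-cancel t<m {+ i} {+ i′} (≈-trans (≈-sym (walk-up₁ k t i<N))
      (subst (λ v → ι (proj₁ v) ≈ + i′ * odd t) (sym eq) (walk-up₁ k t i′<N)))))

  down-injective : ∀ k {t t′ i i′} → t ℕ.< m → i ℕ.< N → i′ ℕ.< N → t ≡ t′ →
                   walk k (down t i) ≡ walk k (down t′ i′) → down t i ≡ down t′ i′
  down-injective k {t} {_} {i} {i′} t<m i<N i′<N refl eq = cong (down t) (≈⇒≡ i<N i′<N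
    (odd-cancel t<m {+ suc i} {+ suc i′} (≈-trans (≈-sym (walk-down₁ k t i<N))
      (subst (λ v → ι (proj₁ v) ≈ + suc i′ * odd t) (sym eq) (walk-down₁ k t i′<N)))
      by ring (+ i) (+ i′)))
    where
    ring : ∀ i i′ → + 1 + i - (+ 1 + i′) ≡ i - i′
    ring = solve-∀

  walk-injective< : ∀ k {s s′} → Index s → Index s′ → walk k s ≡ walk k s′ → s ≡ s′
  walk-injective< k (at-up t<m i<N) (at-up t′<m i′<N) eq =
    up-injective k t<m i<N i′<N (up-phase k (ℕ.<⇒≤ t<m) (ℕ.<⇒≤ t′<m) i<N i′<N eq) eq
  walk-injective< k (at-up t<m i<N) (at-down t′<m i′<N) eq =
    contradiction eq (up≢down k (ℕ.<⇒≤ t<m) t′<m i<N i′<N)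
  walk-injective< k (at-down t<m i<N) (at-up t′<m i′<N) eq =
    contradiction (sym eq) (up≢down k (ℕ.<⇒≤ t′<m) t<m i′<N i<N)
  walk-injective< k (at-down t<m i<N) (at-down t′<m i′<N) eq =
    down-injective k t<m i<N i′<N (down-phase k t<m t′<m i<N i′<N eq) eq

  end≢ : ∀ k {s} → Index s → walk k s ≢ walk k (up m 0)
  end≢ k (at-up t<m i<N) eq = ℕ.<⇒≢ t<m (up-phase k (ℕ.<⇒≤ t<m) ℕ.≤-refl i<N z<s eq)
  end≢ k (at-down t<m i<N) eq = up≢down k ℕ.≤-refl t<m z<s i<N (sym eq)

  walk-injective : ∀ k {s s′} → s ℕ.≤ N ℕ.* (m ℕ.* 2) → s′ ℕ.≤ N ℕ.* (m ℕ.* 2) →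
                   walk k s ≡ walk k s′ → s ≡ s′
  walk-injective k s≤ s′≤ eq with ℕ.m≤n⇒m<n∨m≡n s≤ | ℕ.m≤n⇒m<n∨m≡n s′≤
  ... | inj₁ s< | inj₁ s′< = walk-injective< k (index s<) (index s′<) eq
  ... | inj₁ s< | inj₂ refl = contradiction (trans eq (cong (walk k) length≡up)) (end≢ k (index s<))
  ... | inj₂ refl | inj₁ s′< = contradiction (trans (sym eq) (cong (walk k) length≡up)) (end≢ k (index s′<))
  ... | inj₂ refl | inj₂ refl = refl

  -- The directed edges of the paths.

  -- Directed edges of the k-th path, described without reference to their position on it;
  -- the last hypothesis of each constructor determines k from the edge.
  data Step (k : Fin N) (v w : Vertex N) : Set where
    vertical : ∀ t → t ℕ.< m → proj₂ v ≡ proj₂ w →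
      ι (proj₁ w) ≈ ι (proj₁ v) + odd t →
      ι (proj₂ v) ≈ + t + ι (proj₁ v) + ι k → Step k v w
    horizontal : ∀ t → t ℕ.< m → proj₁ v ≡ proj₁ w → ¬ ι (proj₁ v) ≈ + 0 →
      ι (proj₂ w) ≈ ι (proj₂ v) + odd t →
      ι (proj₂ v) + + suc t ≈ ι (proj₁ v) + ι k → Step k v w
    turn : ∀ t → t ℕ.< m → proj₁ v ≡ proj₁ w → ι (proj₁ v) ≈ + 0 →
      ι (proj₂ w) ≈ ι (proj₂ v) + even t →
      ι (proj₂ v) + + suc t ≈ ι k → Step k v w

  up-step : ∀ k {t i} → t ℕ.< m → i ℕ.< N → Step k (walk k (up t i)) (walk k (down t i))
  up-step k {t} {i} t<m i<N = vertical t t<m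
    (ι-injective (≈-trans (walk-up₂ k t i<N) (≈-sym (walk-down₂ k t i<N))))
    (walk-down₁ k t i<N ⊟ walk-up₁ k t i<N by
      ring₁ (ι (proj₁ (walk k (up t i)))) (ι (proj₁ (walk k (down t i)))) (+ i) (odd t))
    (slope-up k t i<N by
      ring₂ (ι (proj₁ (walk k (up t i)))) (ι (proj₂ (walk k (up t i)))) (+ t) (ι k))
    where
    ring₁ : ∀ v w i o → w - v - ((+ 1 + i) * o - i * o) ≡ w - (v + o)
    ring₁ = solve-∀
    ring₂ : ∀ a b t k → b - a - (t + k) ≡ b - (t + a + k)
    ring₂ = solve-∀

  -- The first coordinate is `suc i * odd t`, which vanishes only when `N` divides `suc i`; before
  -- the end of the phase the step is therefore not a `turn`.
  down-step : ∀ k {t i} → t ℕ.< m → i ℕ.< N → suc i ℕ.< N →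
              Step k (walk k (down t i)) (walk k (up t (suc i)))
  down-step k {t} {i} t<m i<N 1+i<N = horizontal t t<m
    (ι-injective (≈-trans (walk-down₁ k t i<N) (≈-sym (walk-up₁ k t 1+i<N))))
    (λ v₁≈0 → ℕ.1+n≢0 (≈⇒≡ 1+i<N z<s
      (odd-cancel t<m {+ suc i} {+ 0} (≈-trans (≈-sym (walk-down₁ k t i<N)) v₁≈0))))
    (walk-up₂ k t 1+i<N ⊟ walk-down₂ k t i<N by
      ring (ι (proj₂ (walk k (down t i)))) (ι (proj₂ (walk k (up t (suc i))))) (+ t) (+ i) (odd t) (ι k))
    (slope-down k t i<N)
    where
    ring : ∀ v w t i o k → w - v - (t + (+ 1 + i) * o + k - (t + i * o + k)) ≡ w - (v + o)
    ring = solve-∀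

  -- At the last pair, `i = m * 2 = N - 1`, the first coordinate is `N * odd t`, that is 0. It stays
  -- 0 while the slope passes from `- (t + 1)` to `t + 1`, which accounts for the increment
  -- `even t`.
  turn-step : ∀ k {t} → t ℕ.< m → Step k (walk k (down t (m ℕ.* 2))) (walk k (up (suc t) 0))
  turn-step k {t} t<m = turn t t<m
    (ι-injective (≈-trans v₁≈0 (≈-sym (walk-up₁ k (suc t) z<s))))
    v₁≈0
    (walk-up₂ k (suc t) {0} z<s ⊟ v₂≈ by
      ring₁ (ι (proj₂ v)) (ι (proj₂ w)) (+ suc t) (odd (suc t)) (ι k))
    v₂≈
    where
    v w : Vertex N
    v = walk k (down t (m ℕ.* 2))
    w = walk k (up (suc t) 0)
    ring₀ : ∀ o n → o * n - o * + 0 ≡ n * o - + 0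
    ring₀ = solve-∀
    ring₁ : ∀ v w s o k → w - (v + s) - (s + + 0 * o + k - k) ≡ w - (v + + 2 * s)
    ring₁ = solve-∀
    ring₂ : ∀ a b s k → b + s + a - (a + k + + 0) ≡ b + s - k
    ring₂ = solve-∀
    v₁≈0 : ι (proj₁ v) ≈ + 0
    v₁≈0 = ≈-trans (walk-down₁ k t {m ℕ.* 2} ℕ.≤-refl) (odd t ⊡ N≈0 by ring₀ (odd t) (+ N))
    v₂≈ : ι (proj₂ v) + + suc t ≈ ι k
    v₂≈ = slope-down k t {m ℕ.* 2} ℕ.≤-refl ⊞ v₁≈0 by ring₂ (ι (proj₁ v)) (ι (proj₂ v)) (+ suc t) (ι k)

  walk-step : ∀ k {s} → Index s → Step k (walk k s) (walk k (suc s))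
  walk-step k (at-up t<m i<N) = up-step k t<m i<N
  walk-step k (at-down {t} {i} t<m i<N) with ℕ.m≤n⇒m<n∨m≡n i<N
  ... | inj₁ 1+i<N = down-step k t<m i<N 1+i<N
  ... | inj₂ 1+i≡N = subst (λ i → Step k (walk k (down t i)) (walk k (up t (suc i))))
                       (ℕ.suc-injective (sym 1+i≡N)) (turn-step k t<m)

  -- Locating every directed edge on its path.

  vertex-≡ : ∀ {v w : Vertex N} → ι (proj₁ v) ≈ ι (proj₁ w) → ι (proj₂ v) ≈ ι (proj₂ w) → v ≡ w
  vertex-≡ p q = cong₂ _,_ (ι-injective p) (ι-injective q)

  Realised : Fin N → Vertex N → Vertex N → Set
  Realised k v w = ∃ λ s → s ℕ.< N ℕ.* (m ℕ.* 2) × walk k s ≡ v × walk k (suc s) ≡ w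

  realise-vertical : ∀ k {a b a′ t i} → t ℕ.< m → i ℕ.< N → + i * odd t ≈ ι a →
                     ι a′ ≈ ι a + odd t → ι b ≈ + t + ι a + ι k → Realised k (a , b) (a′ , b)
  realise-vertical k {a} {b} {a′} {t} {i} t<m i<N io≈a a′≈ b≈ =
    up t i , ℕ.<-trans (ℕ.n<1+n _) (down<length t<m i<N) ,
    vertex-≡ (≈-trans (walk-up₁ k t i<N) io≈a) (coord₂ (walk-up₂ k t i<N)) ,
    vertex-≡
      (walk-down₁ k t i<N ⊞ io≈a ⊟ a′≈ by
        ring₁ (ι (proj₁ (walk k (down t i)))) (+ i) (odd t) (ι a) (ι a′))
      (coord₂ (walk-down₂ k t i<N))
    where
    ring₁ : ∀ x i o a a′ → x + i * o - a′ - ((+ 1 + i) * o + a - (a + o)) ≡ x - a′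
    ring₁ = solve-∀
    ring₂ : ∀ x t i o k a b → x + i * o - b - (t + i * o + k + a - (t + a + k)) ≡ x - b
    ring₂ = solve-∀
    coord₂ : ∀ {x} → x ≈ + t + + i * odd t + ι k → x ≈ ι b
    coord₂ {x} p = p ⊞ io≈a ⊟ b≈ by ring₂ x (+ t) (+ i) (odd t) (ι k) (ι a) (ι b)

  realise-horizontal : ∀ k {a b b′ t i} → t ℕ.< m → suc i ℕ.< N → + suc i * odd t ≈ ι a →
                       ι b′ ≈ ι b + odd t → ι b + + suc t ≈ ι a + ι k →
                       Realised k (a , b) (a , b′)
  realise-horizontal k {a} {b} {b′} {t} {i} t<m 1+i<N io≈a b′≈ b≈ =
    down t i , down<length t<m i<N ,
    vertex-≡
      (≈-trans (walk-down₁ k t i<N) io≈a)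
      (walk-down₂ k t i<N ⊞ io≈a ⊟ b≈ by
        ring₁ (ι (proj₂ (walk k (down t i)))) (+ t) (+ i) (ι k) (ι a) (ι b)) ,
    vertex-≡
      (≈-trans (walk-up₁ k t 1+i<N) io≈a)
      (walk-up₂ k t 1+i<N ⊞ io≈a ⊟ b≈ ⊟ b′≈ by
        ring₂ (ι (proj₂ (walk k (up t (suc i))))) (+ t) (+ i) (ι k) (ι a) (ι b) (ι b′))
    where
    i<N : i ℕ.< N
    i<N = ℕ.<-trans (ℕ.n<1+n i) 1+i<N
    ring₁ : ∀ x t i k a b → x + (+ 1 + i) * (+ 1 + + 2 * t) - (b + (+ 1 + t))
      - (t + i * (+ 1 + + 2 * t) + k + a - (a + k)) ≡ x - b
    ring₁ = solve-∀
    ring₂ : ∀ x t i k a b b′ → x + (+ 1 + i) * (+ 1 + + 2 * t) - (b + (+ 1 + t)) - b′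
      - (t + (+ 1 + i) * (+ 1 + + 2 * t) + k + a - (a + k) - (b + (+ 1 + + 2 * t))) ≡ x - b′
    ring₂ = solve-∀

  realise-turn : ∀ k {a b b′ t} → t ℕ.< m → ι a ≈ + 0 → ι b′ ≈ ι b + even t →
                 ι b + + suc t ≈ ι k → Realised k (a , b) (a , b′)
  realise-turn k {a} {b} {b′} {t} t<m a≈0 b′≈ b≈ =
    down t (m ℕ.* 2) , down<length {i = m ℕ.* 2} t<m ℕ.≤-refl ,
    vertex-≡
      (walk-down₁ k t {m ℕ.* 2} ℕ.≤-refl ⊞ odd t ⊡ N≈0 ⊟ a≈0 by
        ring₀ (ι (proj₁ v)) (+ N) (odd t) (ι a))
      (walk-down₂ k t {m ℕ.* 2} ℕ.≤-refl ⊞ odd t ⊡ N≈0 ⊟ b≈ by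
        ring₁ (ι (proj₂ v)) (+ t) (+ (m ℕ.* 2)) (ι k) (ι b)) ,
    vertex-≡
      (walk-up₁ k (suc t) {0} z<s ⊟ a≈0 by
        ring₂ (ι (proj₁ w)) (odd (suc t)) (ι a))
      (walk-up₂ k (suc t) {0} z<s ⊟ b′≈ ⊟ b≈ by
        ring₃ (ι (proj₂ w)) (+ suc t) (odd (suc t)) (ι k) (ι b) (ι b′))
    where
    v w : Vertex N
    v = walk k (down t (m ℕ.* 2))
    w = walk k (up (suc t) 0)
    ring₀ : ∀ x n o a → x + o * n - a - (n * o + o * + 0 - + 0) ≡ x - a
    ring₀ = solve-∀
    ring₁ : ∀ x t n k b → x + (+ 1 + + 2 * t) * (+ 1 + n) - (b + (+ 1 + t))
      - (t + n * (+ 1 + + 2 * t) + k + (+ 1 + + 2 * t) * + 0 - k) ≡ x - b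
    ring₁ = solve-∀
    ring₂ : ∀ x o a → x - a - (+ 0 * o - + 0) ≡ x - a
    ring₂ = solve-∀
    ring₃ : ∀ x s o k b b′ → x - b′ - (b + s) - (s + + 0 * o + k - (b + + 2 * s) - k) ≡ x - b′
    ring₃ = solve-∀

  -- Converse of `walk-step`. The edge supplies the phase `t`; the position within it is found by
  -- solving `i * odd t ≈ ι a`, except that a turn is always the last step of its phase.
  realise : ∀ k {v w} → Step k v w → Realised k v w
  realise k {a , b} {a′ , _} (vertical t t<m refl a′≈ b≈) =
    realise-vertical k {a} {b} {a′} {t} t<m (proj₁ (proj₂ i)) (proj₂ (proj₂ i)) a′≈ b≈
    where
    i : ∃ λ i → i ℕ.< N × + i * odd t ≈ ι a
    i = odd-solve t<m (ι a)
  realise k {a , b} {_ , b′} (turn t t<m refl a≈0 b′≈ b≈) =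
    realise-turn k {a} {b} {b′} {t} t<m a≈0 b′≈ b≈
  realise k {a , b} {_ , b′} (horizontal t t<m refl a≉0 b′≈ b≈) = nonzero (odd-solve t<m (ι a))
    where
    nonzero : (∃ λ i → i ℕ.< N × + i * odd t ≈ ι a) → Realised k (a , b) (a , b′)
    -- The first coordinate at `down t i` is `suc i * odd t`, so the solution found is one more than
    -- the position; the solution 0 would force `a ≈ 0`, the case of a turn.
    nonzero (zero  , _ , 0≈a)        = contradiction (≈-sym 0≈a) a≉0
    nonzero (suc i , 1+i<N , io≈a)   = realise-horizontal k {a} {b} {b′} {t} {i} t<m 1+i<N io≈a b′≈ b≈

  -- Each edge lies on at most one path.

  odd⇒≢ : ∀ {a b : Fin N} {t} → t ℕ.< m → ι b ≈ ι a + odd t → a ≢ b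
  odd⇒≢ {a} {_} {t} t<m p refl = odd≉0 t<m (≈-sym p by ring (ι a) (odd t))
    where
    ring : ∀ a o → a + o - a ≡ o - + 0
    ring = solve-∀

  even⇒≢ : ∀ {a b : Fin N} {t} → t ℕ.< m → ι b ≈ ι a + even t → a ≢ b
  even⇒≢ {a} {_} {t} t<m p refl = even≉0 t<m (≈-sym p by ring (ι a) (even t))
    where
    ring : ∀ a o → a + o - a ≡ o - + 0
    ring = solve-∀

  step⇒adj : ∀ {k v w} → Step k v w → Adj N v w
  step⇒adj (vertical t t<m v₂≡w₂ w₁≈ _)       = odd⇒≢ t<m w₁≈ ∘ cong proj₁ , inj₂ v₂≡w₂
  step⇒adj (horizontal t t<m v₁≡w₁ _ w₂≈ _)   = odd⇒≢ t<m w₂≈ ∘ cong proj₂ , inj₁ v₁≡w₁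
  step⇒adj (turn t t<m v₁≡w₁ _ w₂≈ _)         = even⇒≢ t<m w₂≈ ∘ cong proj₂ , inj₁ v₁≡w₁

  forward-unique : ∀ x y a b → y ≈ x + a → y ≈ x + b → a ≈ b
  forward-unique x y a b p q = q ⊟ p by ring x y a b
    where
    ring : ∀ x y a b → y - y - (x + b - (x + a)) ≡ a - b
    ring = solve-∀

  there-and-back : ∀ x y a b → y ≈ x + a → x ≈ y + b → a + b ≈ + 0
  there-and-back x y a b p q = ⊖ p ⊟ q by ring x y a b
    where
    ring : ∀ x y a b → - y - x - (- (x + a) - (y + b)) ≡ a + b - + 0
    ring = solve-∀

  +-cancelˡ-ι : ∀ x y {k k′} → y ≈ x + ι k → y ≈ x + ι k′ → k ≡ k′
  +-cancelˡ-ι x y {k} {k′} p q = ι-injective (forward-unique x y (ι k) (ι k′) p q)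

  -- The changed coordinate and the vanishing of the first coordinate fix the kind of step, the
  -- increment fixes `t`, and the remaining congruence can then be solved for the index.
  step-unique : ∀ {k k′ v w} → Step k v w → Step k′ v w → k ≡ k′
  step-unique {k} {k′} {v} {w} = go
    where
    a b a′ b′ : ℤ
    a  = ι (proj₁ v)
    b  = ι (proj₂ v)
    a′ = ι (proj₁ w)
    b′ = ι (proj₂ w)
    go : Step k v w → Step k′ v w → k ≡ k′
    go (vertical t t<m _ a′≈ b≈) (vertical t′ t′<m _ a′≈₂ b≈₂) =
      +-cancelˡ-ι (+ t + a) b b≈ (subst (λ t → b ≈ + t + a + ι k′)
        (odd-injective t′<m t<m (forward-unique a a′ (odd t′) (odd t) a′≈₂ a′≈)) b≈₂)
    go (vertical t t<m _ a′≈ _) (horizontal _ _ v₁≡w₁ _ _ _) = contradiction v₁≡w₁ (odd⇒≢ t<m a′≈)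
    go (vertical t t<m _ a′≈ _) (turn _ _ v₁≡w₁ _ _ _) = contradiction v₁≡w₁ (odd⇒≢ t<m a′≈)
    go (horizontal _ _ v₁≡w₁ _ _ _) (vertical _ t<m _ a′≈ _) = contradiction v₁≡w₁ (odd⇒≢ t<m a′≈)
    go (horizontal t t<m _ _ b′≈ b≈) (horizontal t′ t′<m _ _ b′≈₂ b≈₂) =
      +-cancelˡ-ι a (b + + suc t) b≈ (subst (λ t → b + + suc t ≈ a + ι k′)
        (odd-injective t′<m t<m (forward-unique b b′ (odd t′) (odd t) b′≈₂ b′≈)) b≈₂)
    go (horizontal _ _ _ a≉0 _ _) (turn _ _ _ a≈0 _ _) = contradiction a≈0 a≉0
    go (turn _ _ v₁≡w₁ _ _ _) (vertical _ t<m _ a′≈ _) = contradiction v₁≡w₁ (odd⇒≢ t<m a′≈)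
    go (turn _ _ _ a≈0 _ _) (horizontal _ _ _ a≉0 _ _) = contradiction a≈0 a≉0
    go (turn t t<m _ _ b′≈ b≈) (turn t′ t′<m _ _ b′≈₂ b≈₂) =
      ι-injective (≈-trans (≈-sym b≈) (subst (λ t → b + + suc t ≈ ι k′)
        (even-injective t′<m t<m (forward-unique b b′ (even t′) (even t) b′≈₂ b′≈)) b≈₂))

  -- An edge and its reverse change the same coordinate, and a horizontal edge has the same first
  -- coordinate at both ends, so both steps are of one kind. Their increments would then sum to 0.
  step-asym : ∀ {k k′ v w} → Step k v w → ¬ Step k′ w v
  step-asym {k} {k′} {v} {w} = go
    where
    a b a′ b′ : ℤ
    a  = ι (proj₁ v)
    b  = ι (proj₂ v)
    a′ = ι (proj₁ w)
    b′ = ι (proj₂ w)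
    go : Step k v w → ¬ Step k′ w v
    go (vertical t t<m _ a′≈ _) (vertical t′ t′<m _ a≈ _) =
      odd-opposite t<m t′<m (there-and-back a a′ (odd t) (odd t′) a′≈ a≈)
    go (vertical t t<m _ a′≈ _) (horizontal _ _ w₁≡v₁ _ _ _) = odd⇒≢ t<m a′≈ (sym w₁≡v₁)
    go (vertical t t<m _ a′≈ _) (turn _ _ w₁≡v₁ _ _ _) = odd⇒≢ t<m a′≈ (sym w₁≡v₁)
    go (horizontal _ _ v₁≡w₁ _ _ _) (vertical _ t<m _ a≈ _) = odd⇒≢ t<m a≈ (sym v₁≡w₁)
    go (horizontal t t<m _ _ b′≈ _) (horizontal t′ t′<m _ _ b≈ _) =
      odd-opposite t<m t′<m (there-and-back b b′ (odd t) (odd t′) b′≈ b≈)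
    go (horizontal _ _ v₁≡w₁ a≉0 _ _) (turn _ _ _ a′≈0 _ _) =
      a≉0 (subst (λ x → ι x ≈ + 0) (sym v₁≡w₁) a′≈0)
    go (turn _ _ v₁≡w₁ _ _ _) (vertical _ t<m _ a≈ _) = odd⇒≢ t<m a≈ (sym v₁≡w₁)
    go (turn _ _ v₁≡w₁ a≈0 _ _) (horizontal _ _ _ a′≉0 _ _) =
      a′≉0 (subst (λ x → ι x ≈ + 0) v₁≡w₁ a≈0)
    go (turn t t<m _ _ b′≈ _) (turn t′ t′<m _ _ b≈ _) =
      even-opposite t<m t′<m (there-and-back b b′ (even t) (even t′) b′≈ b≈)

  -- Each edge lies on some path.

  ≢⇒≉ : ∀ {a b : Fin N} → a ≢ b → ¬ ι b - ι a ≈ + 0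
  ≢⇒≉ {a} {b} a≢b p = a≢b (sym (ι-injective (p by ring (ι a) (ι b))))
    where
    ring : ∀ a b → b - a - + 0 ≡ b - a
    ring = solve-∀

  difference : ∀ a b d → b - a ≈ d → b ≈ a + d
  difference a b d p = p by ring a b d
    where
    ring : ∀ a b d → b - a - d ≡ b - (a + d)
    ring = solve-∀

  difference⁻ : ∀ a b d → - (b - a) ≈ d → a ≈ b + d
  difference⁻ a b d p = p by ring a b d
    where
    ring : ∀ a b d → - (b - a) - d ≡ a - (b + d)
    ring = solve-∀

  Oriented : Vertex N → Vertex N → Set
  Oriented v w = ∃ λ k → Step k v w ⊎ Step k w v

  -- `±odd` chooses the direction and the phase; the path index is then the solution of the slope
  -- equation at the chosen starting end. The two horizontal cases follow the same pattern.
  vertical-oriented : ∀ {a b c} → a ≢ c → Oriented (a , b) (c , b)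
  vertical-oriented {a} {b} {c} a≢c = orient (±odd (ι c - ι a) (≢⇒≉ a≢c))
    where
    start : ∀ a t → ι b ≈ + t + ι a + ι (residue (ι b - (+ t + ι a)))
    start a t = ≈-sym (ι-residue (ι b - (+ t + ι a))
      by ring (ι (residue (ι b - (+ t + ι a)))) (+ t + ι a) (ι b))
      where
      ring : ∀ r s b → r - (b - s) ≡ s + r - b
      ring = solve-∀
    orient : (∃ λ t → t ℕ.< m × (ι c - ι a ≈ odd t ⊎ - (ι c - ι a) ≈ odd t)) →
             Oriented (a , b) (c , b)
    orient (t , t<m , inj₁ p) = residue (ι b - (+ t + ι a)) ,
      inj₁ (vertical t t<m refl (difference (ι a) (ι c) (odd t) p) (start a t))
    orient (t , t<m , inj₂ p) = residue (ι b - (+ t + ι c)) ,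
      inj₂ (vertical t t<m refl (difference⁻ (ι a) (ι c) (odd t) p) (start c t))

  horizontal-oriented : ∀ {a b d} → b ≢ d → ¬ ι a ≈ + 0 → Oriented (a , b) (a , d)
  horizontal-oriented {a} {b} {d} b≢d a≉0 = orient (±odd (ι d - ι b) (≢⇒≉ b≢d))
    where
    start : ∀ b t → ι b + + suc t ≈ ι a + ι (residue (ι b + + suc t - ι a))
    start b t = ≈-sym (ι-residue (ι b + + suc t - ι a)
      by ring (ι (residue (ι b + + suc t - ι a))) (ι a) (ι b + + suc t))
      where
      ring : ∀ r a s → r - (s - a) ≡ a + r - s
      ring = solve-∀
    orient : (∃ λ t → t ℕ.< m × (ι d - ι b ≈ odd t ⊎ - (ι d - ι b) ≈ odd t)) →
             Oriented (a , b) (a , d)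
    orient (t , t<m , inj₁ p) = residue (ι b + + suc t - ι a) ,
      inj₁ (horizontal t t<m refl a≉0 (difference (ι b) (ι d) (odd t) p) (start b t))
    orient (t , t<m , inj₂ p) = residue (ι d + + suc t - ι a) ,
      inj₂ (horizontal t t<m refl a≉0 (difference⁻ (ι b) (ι d) (odd t) p) (start d t))

  turn-oriented : ∀ {a b d} → b ≢ d → ι a ≈ + 0 → Oriented (a , b) (a , d)
  turn-oriented {a} {b} {d} b≢d a≈0 = orient (±even (ι d - ι b) (≢⇒≉ b≢d))
    where
    orient : (∃ λ t → t ℕ.< m × (ι d - ι b ≈ even t ⊎ - (ι d - ι b) ≈ even t)) →
             Oriented (a , b) (a , d)
    orient (t , t<m , inj₁ p) = residue (ι b + + suc t) ,
      inj₁ (turn t t<m refl a≈0 (difference (ι b) (ι d) (even t) p) (≈-sym (ι-residue (ι b + + suc t))))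
    orient (t , t<m , inj₂ p) = residue (ι d + + suc t) ,
      inj₂ (turn t t<m refl a≈0 (difference⁻ (ι b) (ι d) (even t) p) (≈-sym (ι-residue (ι d + + suc t))))

  adj⇒oriented : ∀ {v w} → Adj N v w → Oriented v w
  adj⇒oriented (v≢w , inj₂ refl) = vertical-oriented (v≢w ∘ cong (_, _))
  adj⇒oriented {a , _} (v≢w , inj₁ refl) with toℕ a ℕ.≟ 0
  ... | yes a≡0 = turn-oriented (v≢w ∘ cong (_ ,_)) (≈-reflexive (cong +_ a≡0))
  ... | no  a≢0 = horizontal-oriented (v≢w ∘ cong (_ ,_)) (a≢0 ∘ ≈⇒≡ (toℕ<n a) z<s)

  -- The paths and the decomposition.

  path-at : Fin N → PathIn N (N ℕ.* (m ℕ.* 2))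
  path-at k = record
    { vert      = walk k ∘ toℕ
    ; injective = λ i j eq → toℕ-injective
        (walk-injective k (ℕ.s≤s⁻¹ (toℕ<n i)) (ℕ.s≤s⁻¹ (toℕ<n j)) eq)
    ; adjacent  = λ s → subst (λ n → Adj N (walk k n) (walk k (suc (toℕ s))))
        (sym (toℕ-inject₁ s)) (step⇒adj (walk-step k (index (toℕ<n s))))
    }

  realised⇒edge : ∀ {k v w} → Realised k v w → EdgeOf (vert (path-at k)) v w
  realised⇒edge {k} {v} {w} (s , s< , v≡ , w≡) = fromℕ< s< , inj₁
    ( trans (cong (walk k) (trans (toℕ-inject₁ (fromℕ< s<)) (toℕ-fromℕ< s<))) v≡
    , trans (cong (walk k ∘ suc) (toℕ-fromℕ< s<)) w≡ )

  EdgeOf-sym : ∀ {l} {u : Fin (suc l) → Vertex N} {v w} → EdgeOf u v w → EdgeOf u w v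
  EdgeOf-sym (s , inj₁ e) = s , inj₂ e
  EdgeOf-sym (s , inj₂ e) = s , inj₁ e

  step⇒edge : ∀ {k v w} → Step k v w ⊎ Step k w v → EdgeOf (vert (path-at k)) v w
  step⇒edge {k} (inj₁ p) = realised⇒edge {k} (realise k p)
  step⇒edge {k} (inj₂ p) = EdgeOf-sym {u = vert (path-at k)} (realised⇒edge {k} (realise k p))

  edge⇒step : ∀ {k v w} → EdgeOf (vert (path-at k)) v w → Step k v w ⊎ Step k w v
  edge⇒step {k} (s , e) = Sum.map orient orient e
    where
    orient : ∀ {v w} → walk k (toℕ (inject₁ s)) ≡ v × walk k (suc (toℕ s)) ≡ w → Step k v w
    orient (v≡ , w≡) = subst₂ (Step k) (trans (cong (walk k) (sym (toℕ-inject₁ s))) v≡) w≡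
      (walk-step k (index (toℕ<n s)))

  step-owner : ∀ {k k′ v w} → Step k v w ⊎ Step k w v → Step k′ v w ⊎ Step k′ w v → k ≡ k′
  step-owner (inj₁ p) (inj₁ q) = step-unique p q
  step-owner (inj₁ p) (inj₂ q) = contradiction q (step-asym p)
  step-owner (inj₂ p) (inj₁ q) = contradiction q (step-asym p)
  step-owner (inj₂ p) (inj₂ q) = step-unique p q

  decomposition : PathDecomposition N (N ℕ.* (m ℕ.* 2))
  decomposition = record
    { k     = N
    ; path  = path-at
    ; cover = λ v w adj → let k , step = adj⇒oriented adj in
        k , step⇒edge step , λ j e → step-owner (edge⇒step e) step
    }

  -- The group of translations

  shift : ℤ → Vertex N → Vertex N
  shift c (a , b) = a , residue (ι b + c)

  shift-∘ : ∀ c d v → shift c (shift d v) ≡ shift (d + c) v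
  shift-∘ c d (a , b) = cong (a ,_) (residue-cong {ι (residue (ι b + d)) + c} {ι b + (d + c)}
    (ι-residue (ι b + d) by ring (ι (residue (ι b + d))) (ι b) c d))
    where
    ring : ∀ r b c d → r - (b + d) ≡ r + c - (b + (d + c))
    ring = solve-∀

  shift-0 : ∀ v → shift (+ 0) v ≡ v
  shift-0 (a , b) = cong (a ,_)
    (trans (cong residue (ℤ.+-identityʳ (ι b))) (residue-ι b))

  shift-inverseˡ : ∀ c v → shift (- c) (shift c v) ≡ v
  shift-inverseˡ c v = trans (shift-∘ (- c) c v)
    (trans (cong (λ d → shift d v) (ℤ.+-inverseʳ c)) (shift-0 v))

  shift-inverseʳ : ∀ c v → shift c (shift (- c) v) ≡ v
  shift-inverseʳ c v = trans (shift-∘ c (- c) v)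
    (trans (cong (λ d → shift d v) (ℤ.+-inverseˡ c)) (shift-0 v))

  shift-adj : ∀ c {v w} → Adj N v w → Adj N (shift c v) (shift c w)
  shift-adj c {v} {w} (v≢w , same) =
    (λ eq → v≢w (trans (sym (shift-inverseˡ c v)) (trans (cong (shift (- c)) eq) (shift-inverseˡ c w)))) ,
    Sum.map id (cong (λ b → residue (ι b + c))) same

  translation : ℤ → Aut N
  translation c = record
    { to       = shift c
    ; from     = shift (- c)
    ; to-from  = shift-inverseʳ c
    ; from-to  = shift-inverseˡ c
    ; adj-pres = λ v w → mk⇔ (shift-adj c) (λ adj →
        subst₂ (Adj N) (shift-inverseˡ c v) (shift-inverseˡ c w) (shift-adj (- c) adj))
    }

  -- Only the action on vertices is compared, since an `Aut` also carries an inverse and proofs.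
  IsTranslation : Aut N → Set
  IsTranslation g = ∃ λ c → ∀ v → to g v ≡ shift c v

  translation-group : IsAutGroup N IsTranslation
  translation-group = record
    { has-id   = translation (+ 0) , (+ 0 , λ _ → refl) , shift-0
    ; has-comp = λ (g h : Aut N) (gt : IsTranslation g) (ht : IsTranslation h) →
        let c , g≡ = gt ; d , h≡ = ht in
        translation (d + c) , (d + c , λ _ → refl) ,
        λ v → sym (trans (g≡ (to h v)) (trans (cong (shift c) (h≡ v)) (shift-∘ c d v)))
    ; has-inv  = λ g gt → let c , g≡ = gt in
        translation (- c) , (- c , λ _ → refl) ,
        -- As `g` maps `shift (- c) v` to `v`, its inverse maps `v` back to `shift (- c) v`.
        λ v → sym (trans (cong (from g) (sym (trans (g≡ (shift (- c) v)) (shift-inverseʳ c v))))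
                    (from-to g (shift (- c) v)))
    }

  same-subgraph : ∀ {l} {u w : Fin (suc l) → Vertex N} → (∀ s → u s ≡ w s) → SameSubgraph u w
  same-subgraph {u = u} {w} u≡w x y = mk⇔ (transport u≡w) (transport (sym ∘ u≡w))
    where
    transport : ∀ {l} {u w : Fin (suc l) → Vertex N} → (∀ s → u s ≡ w s) →
                EdgeOf u x y → EdgeOf w x y
    transport u≡w (s , inj₁ (p , q)) = s , inj₁ (trans (sym (u≡w _)) p , trans (sym (u≡w _)) q)
    transport u≡w (s , inj₂ (p , q)) = s , inj₂ (trans (sym (u≡w _)) p , trans (sym (u≡w _)) q)

  shift-walk : ∀ k l c s → ι k + c ≈ ι l → shift c (walk k s) ≡ walk l s
  shift-walk k l c s k+c≈l = cong₂ _,_ (walk-shift₁ k l s) (walk-shift k l c s k+c≈l)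

  -- A shift by `c` carries path `i` to the path indexed by `i + c` vertex by vertex, hence also as
  -- a subgraph; the shift by `j - i` carries path `i` to path `j`.
  transitive : IsGTransitive IsTranslation decomposition
  transitive =
    (λ i g gt → let c , g≡ = gt in residue (ι i + c) ,
      same-subgraph {u = to g ∘ walk i ∘ toℕ}
        {walk (residue (ι i + c)) ∘ toℕ}
        (λ s → trans (g≡ (walk i (toℕ s)))
          (shift-walk i (residue (ι i + c)) c (toℕ s) (≈-sym (ι-residue (ι i + c)))))) ,
    (λ i j → translation (ι j - ι i) , (ι j - ι i , λ _ → refl) ,
      same-subgraph (λ s → shift-walk i j (ι j - ι i) (toℕ s)
        (≈-reflexive (ring (ι i) (ι j)))))
    where
    ring : ∀ i j → i + (j - i) ≡ j
    ring = solve-∀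

  transitive-decomposition : Σ (PathDecomposition N (N ℕ.* (m ℕ.* 2))) IsTransitive
  transitive-decomposition = decomposition , IsTranslation , translation-group , transitive

-- Specialisation to odd primes.

open import Data.Nat using (_*_; _∸_)
open import Data.Nat.Divisibility using (_∣_)

theorem2 : (n : ℕ) → Prime n → ¬ (2 ∣ n) →
    Σ (PathDecomposition n (n * (n ∸ 1))) IsTransitive
theorem2 n n-prime odd-n with parity n
... | q , inj₁ refl = contradiction (ℕ.divides-refl q) odd-n
-- With `n = suc (q * 2)` the length `n * (n ∸ 1)` reduces to that of the construction with `m = q`.
... | q , inj₂ refl = Construction.transitive-decomposition q n-prime
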